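{- Let $Q$ be a $\partial_\psi$-delta operator with $\partial_\psi$-basic polynomial sequence $(q_n)$, let $S\in\Sigma_\psi$ be invertible and let $(s_n)$, $s_n=S^{ -1}q_n$, be the Sheffer $\psi$-polynomials of $Q$ relative to $S$. Then for every $T\in\Sigma_\psi$, every $p\in P$ and every $y\in F$, $$T\,p(x+_\psi y)=\sum_{k\ge0}\frac{s_k(y)}{k_\psi!}\,Q^k\,S\,T\,p(x),$$ where $p(x+_\psi y):=(E^y(\partial_\psi)p)(x)$ and operators act in the variable $x$.
   Context: Let $F$ be a field of characteristic $0$, $P=F[x]$. Fix $(\psi_n)_{n\ge0}$ in $F$ with $\psi_0=1$, $\psi_n\ne0$, $\psi_{ -1}=0$; $n_\psi=\psi_{n-1}/\psi_n$, $n_\psi!=1/\psi_n$, $0_\psi!=1$. $\partial_\psi x^n=n_\psi x^{n-1}$ (linear); $E^a(\partial_\psi)=\sum_k\frac{a^k}{k_\psi!}\partial_\psi^k$. $\Sigma_\psi$: algebra of linear operators on $P$ commuting with all $E^a(\partial_\psi)$. A $\partial_\psi$-delta operator is $Q\in\Sigma_\psi$ with $Q(x)$ a nonzero constant; its $\partial_\psi$-basic sequence: $\deg q_n=n$, $q_0=1$, $q_n(0)=0$ for $n>0$, $Qq_n=n_\psi q_{n-1}$. Sheffer $\psi$-polynomials of $Q$: $\deg s_n=n$, $s_0$ a nonzero constant, $Qs_n=n_\psi s_{n-1}$. -}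

module Defs where

open import Level using (_⊔_)
open import Algebra.Apartness.Bundles using (HeytingField; HeytingCommutativeRing)
import Algebra.Apartness.Properties.HeytingCommutativeRing as HeytingProperties
open import Algebra.Bundles using (CommutativeRing; Semiring)
import Algebra.Definitions.RawMonoid as RawMonoidDefinitions
import Algebra.Definitions.RawSemiring as RawSemiringDefinitions
open import Algebra.Module.Bundles.Raw using (RawLeftModule)
open import Algebra.Module.Morphism.Structures using (module LeftModuleMorphisms)
open import Data.Fin.Base using (toℕ)
open import Data.List.Base using (List; []; _∷_; length; map; replicate; _++_)
open import Data.Nat.Base as ℕ using (ℕ; zero; suc)
import Data.Nat.Properties as ℕ
open import Data.Product.Base using (∃-syntax; _×_; _,_; proj₁; proj₂)
import Function.Endo.Propositional as Endo
open import Function.Definitions using (Inverseᵇ)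
open import Relation.Binary.PropositionalEquality.Core as ≡ using (_≡_)

-- Fields are the library's Heyting fields: `x # 0#` says that x is nonzero,
-- and is equivalent to x being invertible.  A field with decidable equality
-- is a Heyting field with `x # y` given by `¬ x ≈ y`.

module FieldNotions {c ℓ₁ ℓ₂} (F : HeytingField c ℓ₁ ℓ₂) where

  open HeytingField F
  open HeytingCommutativeRing heytingCommutativeRing using (commutativeRing)
  open CommutativeRing commutativeRing using (semiring)
  open RawSemiringDefinitions (Semiring.rawSemiring semiring) public
    using (_^_) renaming (_×_ to _·_)
  open HeytingProperties heytingCommutativeRing using (x-0≈x; invertibleˡ⇒#)

  CharacteristicZero : Set ℓ₂
  CharacteristicZero = ∀ n → (suc n · 1#) # 0#

  reciprocal : ∀ x → x # 0# → Carrier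
  reciprocal x x#0 = proj₁ (#⇒invertible x#0)

  reciprocal-inverseˡ : ∀ x (x#0 : x # 0#) → reciprocal x x#0 * x ≈ 1#
  reciprocal-inverseˡ x x#0 =
    trans (*-congˡ (sym (x-0≈x x))) (proj₁ (proj₂ (#⇒invertible x#0)))

  reciprocal#0 : ∀ x (x#0 : x # 0#) → reciprocal x x#0 # 0#
  reciprocal#0 x x#0 = invertibleˡ⇒#
    (x , trans (*-congˡ (x-0≈x _)) (trans (*-comm _ _) (reciprocal-inverseˡ x x#0)))

  divide : ∀ x y → y # 0# → Carrier
  divide x y y#0 = x * reciprocal y y#0

  record ψ-Sequence : Set (c ⊔ ℓ₁ ⊔ ℓ₂) where
    field
      ψ    : ℕ → Carrier
      ψ₀≈1 : ψ 0 ≈ 1#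
      ψ#0  : ∀ n → ψ n # 0#

-- A polynomial is its list of coefficients, constant term first.  Trailing
-- zeros are allowed, so polynomials are compared coefficientwise.

module Polynomials {c ℓ₁ ℓ₂} (F : HeytingField c ℓ₁ ℓ₂) where

  open HeytingField F

  Poly : Set c
  Poly = List Carrier

  coeff : Poly → ℕ → Carrier
  coeff []      _       = 0#
  coeff (a ∷ _) zero    = a
  coeff (_ ∷ p) (suc n) = coeff p n

  infix  4 _≈ᴾ_
  infixl 6 _+ᴾ_
  infixr 7 _*ᴾ_

  _≈ᴾ_ : Poly → Poly → Set ℓ₁
  p ≈ᴾ q = ∀ n → coeff p n ≈ coeff q n

  _+ᴾ_ : Poly → Poly → Poly
  []      +ᴾ q       = q
  (a ∷ p) +ᴾ []      = a ∷ p
  (a ∷ p) +ᴾ (b ∷ q) = (a + b) ∷ (p +ᴾ q)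

  _*ᴾ_ : Carrier → Poly → Poly
  a *ᴾ p = map (a *_) p

  0ᴾ : Poly
  0ᴾ = []

  const : Carrier → Poly
  const a = a ∷ []

  x^_ : ℕ → Poly
  x^ n = replicate n 0# ++ const 1#

  eval : Poly → Carrier → Carrier
  eval []      y = 0#
  eval (a ∷ p) y = a + y * eval p y

  HasDegree : Poly → ℕ → Set (ℓ₁ ⊔ ℓ₂)
  HasDegree p n = coeff p n # 0# × (∀ m → n ℕ.< m → coeff p m ≈ 0#)

  polyModule : RawLeftModule Carrier c ℓ₁
  polyModule = record
    { Carrierᴹ = Poly
    ; _≈ᴹ_     = _≈ᴾ_
    ; _+ᴹ_     = _+ᴾ_
    ; _*ₗ_     = _*ᴾ_
    ; 0ᴹ       = 0ᴾ
    ; -ᴹ_      = map (-_)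
    }

  open Endo Poly public using () renaming (Endo to Operator; _^_ to _^ᴼ_)

  open LeftModuleMorphisms polyModule polyModule public
    using () renaming (IsLeftModuleHomomorphism to IsLinear)

  IsInverse : Operator → Operator → Set (c ⊔ ℓ₁)
  IsInverse S S⁻¹ = Inverseᵇ _≈ᴾ_ _≈ᴾ_ S S⁻¹

  sum<_ : ℕ → (ℕ → Poly) → Poly
  (sum< N) f =
    RawMonoidDefinitions.sum (RawLeftModule.+ᴹ-rawMonoid polyModule) {N} (λ i → f (toℕ i))

  -- The series Σ_{k≥0} f k has only finitely many nonzero terms, and their
  -- sum is p.
  _SumsTo_ : (ℕ → Poly) → Poly → Set ℓ₁
  f SumsTo p = ∃[ N ] (∀ k → N ℕ.≤ k → f k ≈ᴾ 0ᴾ) × (sum< N) f ≈ᴾ p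

module ψ-Calculus {c ℓ₁ ℓ₂} (F : HeytingField c ℓ₁ ℓ₂)
                  (seq : FieldNotions.ψ-Sequence F) where

  open HeytingField F
  open FieldNotions F
  open ψ-Sequence seq
  open Polynomials F

  -- ψ at n - 1, where ψ₋₁ = 0.
  ψ-pred : ℕ → Carrier
  ψ-pred zero    = 0#
  ψ-pred (suc n) = ψ n

  [_]ψ : ℕ → Carrier
  [ n ]ψ = divide (ψ-pred n) (ψ n) (ψ#0 n)

  [_]ψ! : ℕ → Carrier
  [ n ]ψ! = divide 1# (ψ n) (ψ#0 n)

  ψ!#0 : ∀ n → [ n ]ψ! # 0#
  ψ!#0 n = #-congʳ (sym (*-identityˡ _)) (reciprocal#0 (ψ n) (ψ#0 n))
    where open HeytingProperties heytingCommutativeRing using (#-congʳ)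

  0ψ!≈1 : [ 0 ]ψ! ≈ 1#
  0ψ!≈1 = trans (*-identityˡ _) (trans (sym (*-identityʳ _))
            (trans (*-congˡ (sym ψ₀≈1)) (reciprocal-inverseˡ (ψ 0) (ψ#0 0))))

  infixl 7 _/[_]ψ!

  _/[_]ψ! : Carrier → ℕ → Carrier
  a /[ k ]ψ! = divide a [ k ]ψ! (ψ!#0 k)

  ∂ψ-from : ℕ → Poly → Poly
  ∂ψ-from n []      = []
  ∂ψ-from n (a ∷ p) = ([ n ]ψ * a) ∷ ∂ψ-from (suc n) p

  ∂ψ : Operator
  ∂ψ []      = []
  ∂ψ (_ ∷ p) = ∂ψ-from 1 p

  -- The series defining E^a(∂ψ) p, cut off at the length of p: by E-sum below
  -- the terms left out all vanish.
  E-term : Carrier → Poly → ℕ → Poly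
  E-term a p k = ((a ^ k) /[ k ]ψ!) *ᴾ (∂ψ ^ᴼ k) p

  E : Carrier → Operator
  E a p = (sum< length p) (E-term a p)

  infix 10 _[x+ψ_]

  _[x+ψ_] : Poly → Carrier → Poly
  p [x+ψ y ] = E y p

  -- Membership of the algebra Σ_ψ.
  record ShiftInvariant (T : Operator) : Set (c ⊔ ℓ₁) where
    field
      isLinear : IsLinear T
      commutes : ∀ a p → T (E a p) ≈ᴾ E a (T p)

  record IsDelta (Q : Operator) : Set (c ⊔ ℓ₁ ⊔ ℓ₂) where
    field
      shiftInvariant : ShiftInvariant Q
      Qx-constant    : ∃[ a ] a # 0# × Q (x^ 1) ≈ᴾ const a

  -- In `lowers` the case n = 0 reads Q q₀ = 0, since [ 0 ]ψ = 0.
  record IsBasic (Q : Operator) (q : ℕ → Poly) : Set (ℓ₁ ⊔ ℓ₂) where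
    field
      degree   : ∀ n → HasDegree (q n) n
      q₀≈1     : q 0 ≈ᴾ const 1#
      vanishes : ∀ n → 0 ℕ.< n → eval (q n) 0# ≈ 0#
      lowers   : ∀ n → Q (q n) ≈ᴾ [ n ]ψ *ᴾ q (ℕ.pred n)

  0ψ≈0 : [ 0 ]ψ ≈ 0#
  0ψ≈0 = zeroˡ _

  coeff-∂ψ-from : ∀ i p n → coeff (∂ψ-from i p) n ≈ [ i ℕ.+ n ]ψ * coeff p n
  coeff-∂ψ-from i []      n       = sym (zeroʳ _)
  coeff-∂ψ-from i (a ∷ p) zero    = reflexive (≡.cong (λ j → [ j ]ψ * a) (≡.sym (ℕ.+-identityʳ i)))
  coeff-∂ψ-from i (a ∷ p) (suc n) = trans (coeff-∂ψ-from (suc i) p n)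
    (reflexive (≡.cong (λ j → [ j ]ψ * coeff p n) (≡.sym (ℕ.+-suc i n))))

  coeff-∂ψ : ∀ p n → coeff (∂ψ p) n ≈ [ suc n ]ψ * coeff p (suc n)
  coeff-∂ψ []      n = sym (zeroʳ _)
  coeff-∂ψ (_ ∷ p) n = coeff-∂ψ-from 1 p n

  coeff-+ᴾ : ∀ p q n → coeff (p +ᴾ q) n ≈ coeff p n + coeff q n
  coeff-+ᴾ []      q       n       = sym (+-identityˡ _)
  coeff-+ᴾ (a ∷ p) []      n       = sym (+-identityʳ _)
  coeff-+ᴾ (a ∷ p) (b ∷ q) zero    = refl
  coeff-+ᴾ (a ∷ p) (b ∷ q) (suc n) = coeff-+ᴾ p q n

  coeff-*ᴾ : ∀ a p n → coeff (a *ᴾ p) n ≈ a * coeff p n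
  coeff-*ᴾ a []      n       = sym (zeroʳ a)
  coeff-*ᴾ a (b ∷ p) zero    = refl
  coeff-*ᴾ a (b ∷ p) (suc n) = coeff-*ᴾ a p n

  ∂ψ-cong : ∀ {p q} → p ≈ᴾ q → ∂ψ p ≈ᴾ ∂ψ q
  ∂ψ-cong {p} {q} p≈q n =
    trans (coeff-∂ψ p n) (trans (*-congˡ (p≈q (suc n))) (sym (coeff-∂ψ q n)))

  ∂ψ-+ᴾ : ∀ p q → ∂ψ (p +ᴾ q) ≈ᴾ ∂ψ p +ᴾ ∂ψ q
  ∂ψ-+ᴾ p q n = trans (coeff-∂ψ (p +ᴾ q) n)
    (trans (*-congˡ (coeff-+ᴾ p q (suc n)))
    (trans (distribˡ _ _ _)
    (trans (+-cong (sym (coeff-∂ψ p n)) (sym (coeff-∂ψ q n)))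
    (sym (coeff-+ᴾ (∂ψ p) (∂ψ q) n)))))

  ∂ψ-*ᴾ : ∀ a p → ∂ψ (a *ᴾ p) ≈ᴾ a *ᴾ ∂ψ p
  ∂ψ-*ᴾ a p n = trans (coeff-∂ψ (a *ᴾ p) n)
    (trans (*-congˡ (coeff-*ᴾ a p (suc n)))
    (trans (sym (*-assoc _ _ _))
    (trans (*-congʳ (*-comm _ _))
    (trans (*-assoc _ _ _)
    (trans (*-congˡ (sym (coeff-∂ψ p n)))
    (sym (coeff-*ᴾ a (∂ψ p) n)))))))

  ∂ψ-x^ : ∀ n → ∂ψ (x^ n) ≈ᴾ [ n ]ψ *ᴾ (x^ ℕ.pred n)
  ∂ψ-x^ zero    zero    = sym (trans (*-congʳ 0ψ≈0) (zeroˡ _))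
  ∂ψ-x^ zero    (suc m) = refl
  ∂ψ-x^ (suc n) m = trans (coeff-∂ψ (x^ suc n) m)
    (trans (shifted n m) (sym (coeff-*ᴾ ([ suc n ]ψ) (x^ n) m)))
    where
    -- The nonzero coefficient of x^ n sits at m = n; i shifts both indices.
    go : ∀ i n m → [ suc (i ℕ.+ m) ]ψ * coeff (x^ n) m ≈ [ suc (i ℕ.+ n) ]ψ * coeff (x^ n) m
    go i zero    zero    = refl
    go i zero    (suc m) = trans (zeroʳ _) (sym (zeroʳ _))
    go i (suc n) zero    = trans (zeroʳ _) (sym (zeroʳ _))
    go i (suc n) (suc m) rewrite ℕ.+-suc i m | ℕ.+-suc i n = go (suc i) n m

    shifted : ∀ n m → [ suc m ]ψ * coeff (x^ n) m ≈ [ suc n ]ψ * coeff (x^ n) m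
    shifted = go 0

  length-∂ψ^ : ∀ k p → length ((∂ψ ^ᴼ k) p) ≡ length p ℕ.∸ k
  length-∂ψ^ zero    p = ≡.refl
  length-∂ψ^ (suc k) p = ≡.trans (length-∂ψ ((∂ψ ^ᴼ k) p))
    (≡.trans (≡.cong ℕ.pred (length-∂ψ^ k p)) (ℕ.pred[m∸n]≡m∸[1+n] (length p) k))
    where
    length-from : ∀ i p → length (∂ψ-from i p) ≡ length p
    length-from i []      = ≡.refl
    length-from i (_ ∷ p) = ≡.cong suc (length-from (suc i) p)

    length-∂ψ : ∀ p → length (∂ψ p) ≡ ℕ.pred (length p)
    length-∂ψ []      = ≡.refl
    length-∂ψ (_ ∷ p) = length-from 1 p

  E-sum : ∀ a p → E-term a p SumsTo E a p
  E-sum a p = length p , vanish , λ _ → refl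
    where
    empty : ∀ b q → length q ≡ 0 → b *ᴾ q ≈ᴾ 0ᴾ
    empty b [] _ n = refl

    vanish : ∀ k → length p ℕ.≤ k → E-term a p k ≈ᴾ 0ᴾ
    vanish k len≤k = empty _ ((∂ψ ^ᴼ k) p)
      (≡.trans (length-∂ψ^ k p) (ℕ.m≤n⇒m∸n≡0 len≤k))

module Submission where

-- Since (Qᵏqₙ)(0) = nψ! δₖₙ, every polynomial has the Taylor expansion
-- v = Σₖ (Qᵏv)(0)/kψ! qₖ, so it is determined by the numbers (Qʲv)(0).  If S
-- commutes with Q, these numbers agree for Eʸv and Σₖ sₖ(y)/kψ! QᵏSv: both are
-- (Qʲv)(y), the first because (Eʸw)(0) = w(y), the second by the Taylor expansion
-- of QʲSv under w ↦ (S⁻¹w)(y).  For S = id this gives Eʸ = Σₖ qₖ(y)/kψ! Qᵏ; as a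
-- field of characteristic zero is infinite, an operator commuting with every Eʸ
-- then commutes with Q.  The theorem is the case v = Tp.

open import Defs
import Level
open import Algebra.Apartness.Bundles using (HeytingField; HeytingCommutativeRing)
open import Algebra.Bundles using (CommutativeRing)
import Algebra.Properties.CommutativeSemigroup as CommutativeSemigroupProperties
import Algebra.Properties.Monoid.Mult as MonoidMult
import Algebra.Properties.Ring as RingProperties
import Algebra.Properties.Semiring.Sum as SemiringSum
open import Data.Fin.Base using (toℕ)
open import Data.List.Base using ([]; _∷_; length)
open import Data.Maybe.Base using (nothing)
open import Data.Nat.Base as ℕ using (ℕ; zero; suc; z≤n; s≤s; _≤_; _<_; _⊔_)
import Data.Nat.Properties as ℕ
open import Data.Product.Base using (_,_; proj₁; proj₂)
open import Data.Sum.Base using (inj₁; inj₂)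
open import Function.Base using (_∘_; id)
import Function.Endo.Propositional as Endo
open import Relation.Binary.PropositionalEquality.Core as ≡ using (_≡_)
import Relation.Binary.Reasoning.Setoid as SetoidReasoning
open import Tactic.RingSolver.Core.AlmostCommutativeRing using (fromCommutativeRing)
import Tactic.RingSolver.NonReflective as RingSolver

-- Cancellation, finite sums and Kronecker deltas in a field.

module FieldLemmas {c ℓ₁ ℓ₂} (F : HeytingField c ℓ₁ ℓ₂) where

  open HeytingCommutativeRing (HeytingField.heytingCommutativeRing F) public
    using (_#_; commutativeRing)
  open CommutativeRing commutativeRing public
  open SemiringSum semiring public
    using (sum; sum-cong-≋; sum-replicate-zero; *-distribˡ-sum)
  open FieldNotions F
  open Polynomials F using (coeff; x^_)

  x*y≈0⇒y≈0 : ∀ {x y} → x # 0# → x * y ≈ 0# → y ≈ 0#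
  x*y≈0⇒y≈0 {x} {y} x#0 xy≈0 = begin
    y                             ≈⟨ *-identityˡ y ⟨
    1# * y                        ≈⟨ *-congʳ (reciprocal-inverseˡ x x#0) ⟨
    reciprocal x x#0 * x * y      ≈⟨ *-assoc _ _ _ ⟩
    reciprocal x x#0 * (x * y)    ≈⟨ *-congˡ xy≈0 ⟩
    reciprocal x x#0 * 0#         ≈⟨ zeroʳ _ ⟩
    0#                            ∎
    where open SetoidReasoning setoid

  ∑< : ℕ → (ℕ → Carrier) → Carrier
  ∑< N f = sum {N} (f ∘ toℕ)

  ∑<-cong : ∀ N {f g} → (∀ k → f k ≈ g k) → ∑< N f ≈ ∑< N g
  ∑<-cong N f≈g = sum-cong-≋ {N} (f≈g ∘ toℕ)

  ∑<-zero : ∀ N → ∑< N (λ _ → 0#) ≈ 0#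
  ∑<-zero = sum-replicate-zero

  -- The coefficients of a monomial serve as the Kronecker delta here and below.
  ∑<-δ : ∀ {N n} → n < N → (a : ℕ → Carrier) → ∑< N (λ k → a k * coeff (x^ n) k) ≈ a n
  ∑<-δ {suc N} {zero}  _         a = begin
    a 0 * 1# + ∑< N (λ k → a (suc k) * 0#)  ≈⟨ +-cong (*-identityʳ _) (∑<-cong N (λ k → zeroʳ (a (suc k)))) ⟩
    a 0 + ∑< N (λ _ → 0#)                   ≈⟨ +-congˡ (∑<-zero N) ⟩
    a 0 + 0#                                ≈⟨ +-identityʳ _ ⟩
    a 0                                     ∎
    where open SetoidReasoning setoid
  ∑<-δ {suc N} {suc n} (s≤s n<N) a =
    trans (+-cong (zeroʳ _) (∑<-δ n<N (a ∘ suc))) (+-identityˡ _)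

  δ-sym : ∀ m n → coeff (x^ m) n ≡ coeff (x^ n) m
  δ-sym zero    zero    = ≡.refl
  δ-sym zero    (suc n) = ≡.refl
  δ-sym (suc m) zero    = ≡.refl
  δ-sym (suc m) (suc n) = δ-sym m n

-- Values of polynomials and division by linear factors.

module Evaluation {c ℓ₁ ℓ₂} (F : HeytingField c ℓ₁ ℓ₂) where

  open FieldLemmas F
  open FieldNotions F using (CharacteristicZero; _·_)
  open Polynomials F
  open RingSolver (fromCommutativeRing commutativeRing (λ _ → nothing))
    using (solve; _⊕_; _⊗_; _⊜_)
  open SetoidReasoning setoid

  coeff-beyond : ∀ p {n} → length p ≤ n → coeff p n ≈ 0#
  coeff-beyond []      _         = refl
  coeff-beyond (_ ∷ p) (s≤s p≤n) = coeff-beyond p p≤n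

  eval-0ᴾ : ∀ p y → p ≈ᴾ 0ᴾ → eval p y ≈ 0#
  eval-0ᴾ []      y p≈0 = refl
  eval-0ᴾ (a ∷ p) y p≈0 = begin
    a + y * eval p y  ≈⟨ +-cong (p≈0 0) (*-congˡ (eval-0ᴾ p y (p≈0 ∘ suc))) ⟩
    0# + y * 0#       ≈⟨ +-identityˡ _ ⟩
    y * 0#            ≈⟨ zeroʳ y ⟩
    0#                ∎

  eval-cong : ∀ p q y → p ≈ᴾ q → eval p y ≈ eval q y
  eval-cong []      q       y p≈q = sym (eval-0ᴾ q y (sym ∘ p≈q))
  eval-cong (a ∷ p) []      y p≈q = eval-0ᴾ (a ∷ p) y p≈q
  eval-cong (a ∷ p) (b ∷ q) y p≈q =
    +-cong (p≈q 0) (*-congˡ (eval-cong p q y (p≈q ∘ suc)))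

  eval-+ᴾ : ∀ p q y → eval (p +ᴾ q) y ≈ eval p y + eval q y
  eval-+ᴾ []      q       y = sym (+-identityˡ _)
  eval-+ᴾ (a ∷ p) []      y = sym (+-identityʳ _)
  eval-+ᴾ (a ∷ p) (b ∷ q) y = trans (+-congˡ (*-congˡ (eval-+ᴾ p q y)))
    (solve 5 (λ a b y P Q → ((a ⊕ b) ⊕ y ⊗ (P ⊕ Q)) ⊜ ((a ⊕ y ⊗ P) ⊕ (b ⊕ y ⊗ Q)))
      refl a b y (eval p y) (eval q y))

  eval-*ᴾ : ∀ a p y → eval (a *ᴾ p) y ≈ a * eval p y
  eval-*ᴾ a []      y = sym (zeroʳ a)
  eval-*ᴾ a (b ∷ p) y = trans (+-congˡ (*-congˡ (eval-*ᴾ a p y)))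
    (solve 4 (λ a b y P → (a ⊗ b ⊕ y ⊗ (a ⊗ P)) ⊜ (a ⊗ (b ⊕ y ⊗ P))) refl a b y (eval p y))

  eval-0# : ∀ p → eval p 0# ≈ coeff p 0
  eval-0# []      = refl
  eval-0# (a ∷ p) = trans (+-congˡ (zeroˡ _)) (+-identityʳ a)

  -- The quotient of a + x p by x - b, for any a.
  horner : Carrier → Poly → Poly
  horner b []      = []
  horner b (a ∷ p) = eval (a ∷ p) b ∷ horner b p

  length-horner : ∀ b p → length (horner b p) ≡ length p
  length-horner b []      = ≡.refl
  length-horner b (_ ∷ p) = ≡.cong suc (length-horner b p)

  -- Division with remainder of x p by x - b, read at x = b + t so that no
  -- subtraction occurs.
  horner-division : ∀ b t p →
    (b + t) * eval p (b + t) ≈ b * eval p b + t * eval (horner b p) (b + t)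
  horner-division b t []      =
    solve 3 (λ b t z → ((b ⊕ t) ⊗ z) ⊜ (b ⊗ z ⊕ t ⊗ z)) refl b t 0#
  horner-division b t (a ∷ p) = trans (*-congˡ (+-congˡ (horner-division b t p)))
    (solve 5 (λ a b t P H →
        ((b ⊕ t) ⊗ (a ⊕ (b ⊗ P ⊕ t ⊗ H))) ⊜
        (b ⊗ (a ⊕ b ⊗ P) ⊕ t ⊗ ((a ⊕ b ⊗ P) ⊕ (b ⊕ t) ⊗ H)))
      refl a b t (eval p b) (eval (horner b p) (b + t)))

  constant-term≈0 : ∀ a p b → p ≈ᴾ 0ᴾ → eval (a ∷ p) b ≈ 0# → a ≈ 0#
  constant-term≈0 a p b p≈0 root = begin
    a                 ≈⟨ +-identityʳ a ⟨
    a + 0#            ≈⟨ +-congˡ (zeroʳ b) ⟨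
    a + b * 0#        ≈⟨ +-congˡ (*-congˡ (eval-0ᴾ p b p≈0)) ⟨
    a + b * eval p b  ≈⟨ root ⟩
    0#                ∎

  -- The entries of the quotient are the values at `b` of the successive tails of `p`, so working
  -- back from the last one makes the coefficients vanish one by one.
  horner≈0⇒≈0 : ∀ b p → horner b p ≈ᴾ 0ᴾ → p ≈ᴾ 0ᴾ
  horner≈0⇒≈0 b []      h≈0 n       = refl
  horner≈0⇒≈0 b (a ∷ p) h≈0 zero    =
    constant-term≈0 a p b (horner≈0⇒≈0 b p (h≈0 ∘ suc)) (h≈0 0)
  horner≈0⇒≈0 b (a ∷ p) h≈0 (suc n) = horner≈0⇒≈0 b p (h≈0 ∘ suc) n

  module _ (char0 : CharacteristicZero) where

    -- Induction on the length: dividing by the linear factor of the first root leaves a shorter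
    -- quotient that vanishes at all later points. The offset `m` lets the list of roots advance
    -- with each division.
    vanishing⇒≈0 : ∀ p m → (∀ d → eval p ((m ℕ.+ d) · 1#) ≈ 0#) → p ≈ᴾ 0ᴾ
    vanishing⇒≈0 p = go (length p) p ≡.refl
      where
      go : ∀ n p → length p ≡ n → ∀ m →
           (∀ d → eval p ((m ℕ.+ d) · 1#) ≈ 0#) → p ≈ᴾ 0ᴾ
      go zero    []      _   m roots i = refl
      go (suc n) (a ∷ p) len m roots = all
        where
        b = m · 1#

        root-b : eval (a ∷ p) b ≈ 0#
        root-b = trans (reflexive
          (≡.cong (λ i → eval (a ∷ p) (i · 1#)) (≡.sym (ℕ.+-identityʳ m)))) (roots 0)

        eval-at : ∀ r {y z} → y ≈ z → eval r y ≈ eval r z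
        eval-at []      y≈z = refl
        eval-at (_ ∷ r) y≈z = +-congˡ (*-cong y≈z (eval-at r y≈z))

        horner-roots : ∀ d → eval (horner b p) ((suc m ℕ.+ d) · 1#) ≈ 0#
        -- The values of `a ∷ p` at `b + t` and at `b` differ by `t * h`. Both are zero, and
        -- characteristic zero lets the factor `t` be cancelled.
        horner-roots d = trans (eval-at (horner b p) split) (x*y≈0⇒y≈0 (char0 d) (begin
          t * h                         ≈⟨ +-identityˡ _ ⟨
          0# + t * h                    ≈⟨ +-congʳ root-b ⟨
          a + b * eval p b + t * h      ≈⟨ +-assoc _ _ _ ⟩
          a + (b * eval p b + t * h)    ≈⟨ +-congˡ (horner-division b t p) ⟨
          eval (a ∷ p) (b + t)          ≈⟨ eval-at (a ∷ p) split ⟨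
          eval (a ∷ p) ((suc m ℕ.+ d) · 1#)
            ≡⟨ ≡.cong (λ i → eval (a ∷ p) (i · 1#)) (ℕ.+-suc m d) ⟨
          eval (a ∷ p) ((m ℕ.+ suc d) · 1#) ≈⟨ roots (suc d) ⟩
          0#                            ∎))
          where
          t = suc d · 1#
          h = eval (horner b p) (b + t)

          split : (suc m ℕ.+ d) · 1# ≈ b + t
          split = trans (reflexive (≡.cong (_· 1#) (≡.sym (ℕ.+-suc m d))))
            (MonoidMult.×-homo-+ +-monoid 1# m (suc d))

        p≈0 : p ≈ᴾ 0ᴾ
        p≈0 = horner≈0⇒≈0 b p (go n (horner b p)
          (≡.trans (length-horner b p) (ℕ.suc-injective len)) (suc m) horner-roots)

        all : a ∷ p ≈ᴾ 0ᴾ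
        all zero    = constant-term≈0 a p b p≈0 root-b
        all (suc i) = p≈0 i

-- Linear forms on polynomials.

module LinearForms {c ℓ₁ ℓ₂} (F : HeytingField c ℓ₁ ℓ₂) (seq : FieldNotions.ψ-Sequence F) where

  open FieldLemmas F
  open FieldNotions F
  open Polynomials F
  open ψ-Calculus F seq
  open Evaluation F
  open RingProperties ring using (-1*x≈-x)
  open CommutativeSemigroupProperties *-commutativeSemigroup using (xy∙z≈xz∙y)
  open SetoidReasoning setoid

  -- Identities between polynomials are proved as scalar identities under an arbitrary form. One
  -- lemma then covers coefficients, values, and either of these composed with operators, and sums
  -- of polynomials become sums in the field.
  record IsLinearForm (φ : Poly → Carrier) : Set (c Level.⊔ ℓ₁) where
    field
      cong   : ∀ u v → u ≈ᴾ v → φ u ≈ φ v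
      +-homo : ∀ u v → φ (u +ᴾ v) ≈ φ u + φ v
      *-homo : ∀ a u → φ (a *ᴾ u) ≈ a * φ u

    0-homo : φ 0ᴾ ≈ 0#
    0-homo = trans (*-homo 0# 0ᴾ) (zeroˡ _)

    sum-homo : ∀ N f → φ ((sum< N) f) ≈ ∑< N (φ ∘ f)
    sum-homo zero    f = 0-homo
    sum-homo (suc N) f = trans (+-homo (f 0) _) (+-congˡ (sum-homo N (f ∘ suc)))

    sum-*-homo : ∀ N (a : ℕ → Carrier) (f : ℕ → Poly) →
      φ ((sum< N) (λ k → a k *ᴾ f k)) ≈ ∑< N (λ k → a k * φ (f k))
    sum-*-homo N a f = trans (sum-homo N (λ k → a k *ᴾ f k)) (∑<-cong N (λ k → *-homo (a k) (f k)))

  open IsLinearForm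

  coeff-isLinearForm : ∀ n → IsLinearForm (λ p → coeff p n)
  coeff-isLinearForm n = record
    { cong   = λ _ _ u≈v → u≈v n
    ; +-homo = λ u v → coeff-+ᴾ u v n
    ; *-homo = λ a u → coeff-*ᴾ a u n
    }

  eval-isLinearForm : ∀ y → IsLinearForm (λ p → eval p y)
  eval-isLinearForm y = record
    { cong   = λ u v → eval-cong u v y
    ; +-homo = λ u v → eval-+ᴾ u v y
    ; *-homo = λ a u → eval-*ᴾ a u y
    }

  -- The difference `d` vanishes at every multiple of `1#`, and characteristic zero provides enough
  -- of these to force `d` to be zero.
  eval-injective : CharacteristicZero → ∀ p q → (∀ y → eval p y ≈ eval q y) → p ≈ᴾ q
  eval-injective char0 p q same n = begin
    coeff p n                           ≈⟨ +-identityʳ _ ⟨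
    coeff p n + 0#                      ≈⟨ +-congˡ (-‿inverseˡ _) ⟨
    coeff p n + (- coeff q n + coeff q n)   ≈⟨ +-assoc _ _ _ ⟨
    coeff p n - coeff q n + coeff q n   ≈⟨ +-congʳ (minus (coeff-isLinearForm n)) ⟨
    coeff d n + coeff q n               ≈⟨ +-congʳ (vanishing⇒≈0 char0 d 0 (λ m → root (m · 1#)) n) ⟩
    0# + coeff q n                      ≈⟨ +-identityˡ _ ⟩
    coeff q n                           ∎
    where
    d = p +ᴾ (- 1#) *ᴾ q

    minus : ∀ {φ} → IsLinearForm φ → φ d ≈ φ p - φ q
    minus φ-form = trans (+-homo φ-form p _)
      (+-congˡ (trans (*-homo φ-form (- 1#) q) (-1*x≈-x _)))

    root : ∀ y → eval d y ≈ 0#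
    root y = trans (minus (eval-isLinearForm y)) (trans (+-congʳ (same y)) (-‿inverseʳ _))

  zero-isLinearForm : IsLinearForm (λ _ → 0#)
  zero-isLinearForm = record
    { cong   = λ _ _ _ → refl
    ; +-homo = λ _ _ → sym (+-identityˡ 0#)
    ; *-homo = λ a _ → sym (zeroʳ a)
    }

  +-isLinearForm : ∀ {φ χ} → IsLinearForm φ → IsLinearForm χ → IsLinearForm (λ v → φ v + χ v)
  +-isLinearForm {φ} {χ} φ-form χ-form = record
    { cong   = λ u v u≈v → +-cong (cong φ-form u v u≈v) (cong χ-form u v u≈v)
    ; +-homo = λ u v → trans (+-cong (+-homo φ-form u v) (+-homo χ-form u v))
        (interchange (φ u) (φ v) (χ u) (χ v))
    ; *-homo = λ a u → trans (+-cong (*-homo φ-form a u) (*-homo χ-form a u))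
        (sym (distribˡ a (φ u) (χ u)))
    }
    where open CommutativeSemigroupProperties +-commutativeSemigroup using (interchange)

  *-isLinearForm : ∀ {φ} → IsLinearForm φ → ∀ a → IsLinearForm (λ v → φ v * a)
  *-isLinearForm {φ} φ-form a = record
    { cong   = λ u v u≈v → *-congʳ (cong φ-form u v u≈v)
    ; +-homo = λ u v → trans (*-congʳ (+-homo φ-form u v)) (distribʳ a (φ u) (φ v))
    ; *-homo = λ b u → trans (*-congʳ (*-homo φ-form b u)) (*-assoc b (φ u) a)
    }

  ∑-isLinearForm : ∀ N {φ : ℕ → Poly → Carrier} → (∀ k → IsLinearForm (φ k)) →
    IsLinearForm (λ v → ∑< N (λ k → φ k v))
  ∑-isLinearForm zero    φ-form = zero-isLinearForm
  ∑-isLinearForm (suc N) φ-form = +-isLinearForm (φ-form 0) (∑-isLinearForm N (φ-form ∘ suc))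

  ∘-isLinearForm : ∀ {φ A} → IsLinearForm φ → IsLinear A → IsLinearForm (φ ∘ A)
  ∘-isLinearForm {φ} {A} φ-form A-linear = record
    { cong   = λ u v u≈v → cong φ-form (A u) (A v) (A-linear.⟦⟧-cong {u} {v} u≈v)
    ; +-homo = λ u v → trans (cong φ-form _ _ (A-linear.+ᴹ-homo u v)) (+-homo φ-form (A u) (A v))
    ; *-homo = λ a u → trans (cong φ-form _ _ (A-linear.*ₗ-homo a u)) (*-homo φ-form a (A u))
    }
    where module A-linear = IsLinear A-linear

  ∘^-isLinearForm : ∀ {φ A} → IsLinearForm φ → IsLinear A → ∀ k → IsLinearForm (φ ∘ (A ^ᴼ k))
  ∘^-isLinearForm φ-form A-linear zero    = φ-form
  ∘^-isLinearForm φ-form A-linear (suc k) = ∘^-isLinearForm (∘-isLinearForm φ-form A-linear) A-linear k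

  ^-comm : ∀ (A : Operator) j k v → (A ^ᴼ j) ((A ^ᴼ k) v) ≡ (A ^ᴼ k) ((A ^ᴼ j) v)
  ^-comm A j k v = ≡.trans (≡.cong (λ B → B v) (≡.sym (^-homo A j k)))
    (≡.trans (≡.cong (λ i → (A ^ᴼ i) v) (ℕ.+-comm j k)) (≡.cong (λ B → B v) (^-homo A k j)))
    where open Endo Poly using (^-homo)

  module Inverses (S S⁻¹ : Operator) (S-linear : IsLinear S) (inverse : IsInverse S S⁻¹) where

    private module S-linear = IsLinear S-linear

    S∘S⁻¹ : ∀ u → S (S⁻¹ u) ≈ᴾ u
    S∘S⁻¹ u = proj₁ inverse {u} {S⁻¹ u} (λ _ → refl)

    inverse-unique : ∀ u v → u ≈ᴾ S v → S⁻¹ u ≈ᴾ v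
    inverse-unique u v = proj₂ inverse {v} {u}

    -- `S⁻¹` inherits congruence and linearity from `S`: the two sides of each law have the same
    -- image under `S`, so `inverse-unique` identifies them.
    ∘-inverse-isLinearForm : ∀ {φ} → IsLinearForm φ → IsLinearForm (φ ∘ S⁻¹)
    ∘-inverse-isLinearForm {φ} φ-form = record
      { cong   = λ u v u≈v → cong φ-form _ _
          (inverse-unique u (S⁻¹ v) λ n → trans (u≈v n) (sym (S∘S⁻¹ v n)))
      ; +-homo = λ u v → trans
          (cong φ-form _ _ (inverse-unique (u +ᴾ v) (S⁻¹ u +ᴾ S⁻¹ v) λ n → begin
            coeff (u +ᴾ v) n                              ≈⟨ coeff-+ᴾ u v n ⟩
            coeff u n + coeff v n                         ≈⟨ +-cong (S∘S⁻¹ u n) (S∘S⁻¹ v n) ⟨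
            coeff (S (S⁻¹ u)) n + coeff (S (S⁻¹ v)) n     ≈⟨ coeff-+ᴾ (S (S⁻¹ u)) (S (S⁻¹ v)) n ⟨
            coeff (S (S⁻¹ u) +ᴾ S (S⁻¹ v)) n              ≈⟨ S-linear.+ᴹ-homo (S⁻¹ u) (S⁻¹ v) n ⟨
            coeff (S (S⁻¹ u +ᴾ S⁻¹ v)) n                  ∎))
          (+-homo φ-form (S⁻¹ u) (S⁻¹ v))
      ; *-homo = λ a u → trans
          (cong φ-form _ _ (inverse-unique (a *ᴾ u) (a *ᴾ S⁻¹ u) λ n → begin
            coeff (a *ᴾ u) n              ≈⟨ coeff-*ᴾ a u n ⟩
            a * coeff u n                 ≈⟨ *-congˡ (S∘S⁻¹ u n) ⟨
            a * coeff (S (S⁻¹ u)) n       ≈⟨ coeff-*ᴾ a (S (S⁻¹ u)) n ⟨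
            coeff (a *ᴾ S (S⁻¹ u)) n      ≈⟨ S-linear.*ₗ-homo a (S⁻¹ u) n ⟨
            coeff (S (a *ᴾ S⁻¹ u)) n      ∎))
          (*-homo φ-form a (S⁻¹ u))
      }

  -- ψ-factorials and the constant term of a ψ-shift.

  /ψ!-*ψ! : ∀ a k → (a /[ k ]ψ!) * [ k ]ψ! ≈ a
  /ψ!-*ψ! a k = trans (*-assoc _ _ _)
    (trans (*-congˡ (reciprocal-inverseˡ [ k ]ψ! (ψ!#0 k))) (*-identityʳ a))

  -- Sheffer series divide the value at `y` by the factorial, whereas Taylor expansions divide the
  -- constant term; this passes between the two.
  /ψ!-*-swap : ∀ a b k → (a /[ k ]ψ!) * b ≈ (b /[ k ]ψ!) * a
  /ψ!-*-swap a b k = trans (*-comm _ _) (trans (sym (*-assoc _ _ _)) (xy∙z≈xz∙y b a _))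

  -- The factors are ψₙ/ψₙ₊₁ and 1/ψₙ, so ψₙ cancels.
  ψ!-suc : ∀ n → [ suc n ]ψ * [ n ]ψ! ≈ [ suc n ]ψ!
  ψ!-suc n = begin
    ψ n * r′ * (1# * r)   ≈⟨ *-congˡ (*-identityˡ r) ⟩
    ψ n * r′ * r          ≈⟨ *-comm _ _ ⟩
    r * (ψ n * r′)        ≈⟨ *-assoc _ _ _ ⟨
    r * ψ n * r′          ≈⟨ *-congʳ (reciprocal-inverseˡ (ψ n) (ψ#0 n)) ⟩
    1# * r′               ∎
    where
    open ψ-Sequence seq
    r  = reciprocal (ψ n) (ψ#0 n)
    r′ = reciprocal (ψ (suc n)) (ψ#0 (suc n))

  -- Each derivative contributes one factor of the quotient (k+n)ψ!/nψ!. The denominator is cleared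
  -- so that `ψ!-suc` suffices for the induction.
  coeff-∂ψ^ : ∀ k p n →
    [ n ]ψ! * coeff ((∂ψ ^ᴼ k) p) n ≈ [ k ℕ.+ n ]ψ! * coeff p (k ℕ.+ n)
  coeff-∂ψ^ zero    p n = refl
  coeff-∂ψ^ (suc k) p n = begin
    [ n ]ψ! * coeff (∂ψ v) n                       ≈⟨ *-congˡ (coeff-∂ψ v n) ⟩
    [ n ]ψ! * ([ suc n ]ψ * coeff v (suc n))       ≈⟨ *-assoc _ _ _ ⟨
    [ n ]ψ! * [ suc n ]ψ * coeff v (suc n)         ≈⟨ *-congʳ (trans (*-comm _ _) (ψ!-suc n)) ⟩
    [ suc n ]ψ! * coeff v (suc n)                  ≈⟨ coeff-∂ψ^ k p (suc n) ⟩
    [ k ℕ.+ suc n ]ψ! * coeff p (k ℕ.+ suc n)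
      ≡⟨ ≡.cong (λ i → [ i ]ψ! * coeff p i) (ℕ.+-suc k n) ⟩
    [ suc k ℕ.+ n ]ψ! * coeff p (suc k ℕ.+ n)      ∎
    where v = (∂ψ ^ᴼ k) p

  constant-term-∂ψ^ : ∀ k p → coeff ((∂ψ ^ᴼ k) p) 0 ≈ [ k ]ψ! * coeff p k
  constant-term-∂ψ^ k p = begin
    v₀                                   ≈⟨ *-identityˡ v₀ ⟨
    1# * v₀                              ≈⟨ *-congʳ 0ψ!≈1 ⟨
    [ 0 ]ψ! * v₀                         ≈⟨ coeff-∂ψ^ k p 0 ⟩
    [ k ℕ.+ 0 ]ψ! * coeff p (k ℕ.+ 0)    ≡⟨ ≡.cong (λ i → [ i ]ψ! * coeff p i) (ℕ.+-identityʳ k) ⟩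
    [ k ]ψ! * coeff p k                  ∎
    where v₀ = coeff ((∂ψ ^ᴼ k) p) 0

  eval-as-∑ : ∀ p y → ∑< (length p) (λ k → y ^ k * coeff p k) ≈ eval p y
  eval-as-∑ []      y = refl
  eval-as-∑ (a ∷ p) y = +-cong (*-identityˡ a) (begin
    ∑< (length p) (λ k → y * y ^ k * coeff p k)
      ≈⟨ ∑<-cong (length p) (λ k → *-assoc y (y ^ k) (coeff p k)) ⟩
    ∑< (length p) (λ k → y * (y ^ k * coeff p k))
      ≈⟨ *-distribˡ-sum {length p} y _ ⟨
    y * ∑< (length p) (λ k → y ^ k * coeff p k)
      ≈⟨ *-congˡ (eval-as-∑ p y) ⟩
    y * eval p y ∎)

  -- The constant term of ∂ψᵏp is kψ! times the k-th coefficient of `p`. This factorial cancels the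
  -- denominator in the series for Eʸ, leaving the ordinary value of `p` for every choice of ψ.
  constant-term-E : ∀ y p → coeff (E y p) 0 ≈ eval p y
  constant-term-E y p = begin
    coeff (E y p) 0
      ≈⟨ sum-*-homo (coeff-isLinearForm 0) (length p) (λ k → (y ^ k) /[ k ]ψ!) (λ k → (∂ψ ^ᴼ k) p) ⟩
    ∑< (length p) (λ k → ((y ^ k) /[ k ]ψ!) * coeff ((∂ψ ^ᴼ k) p) 0)
      ≈⟨ ∑<-cong (length p) (λ k → begin
           ((y ^ k) /[ k ]ψ!) * coeff ((∂ψ ^ᴼ k) p) 0     ≈⟨ *-congˡ (constant-term-∂ψ^ k p) ⟩
           ((y ^ k) /[ k ]ψ!) * ([ k ]ψ! * coeff p k)     ≈⟨ *-assoc _ _ _ ⟨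
           ((y ^ k) /[ k ]ψ!) * [ k ]ψ! * coeff p k       ≈⟨ *-congʳ (/ψ!-*ψ! (y ^ k) k) ⟩
           y ^ k * coeff p k                              ∎) ⟩
    ∑< (length p) (λ k → y ^ k * coeff p k)
      ≈⟨ eval-as-∑ p y ⟩
    eval p y ∎

-- Basic sequences and their Taylor expansions.

module BasicSequences {c ℓ₁ ℓ₂} (F : HeytingField c ℓ₁ ℓ₂) (seq : FieldNotions.ψ-Sequence F)
  {Q : Polynomials.Operator F} (Q∈Σ : ψ-Calculus.ShiftInvariant F seq Q)
  {q : ℕ → Polynomials.Poly F} (q-basic : ψ-Calculus.IsBasic F seq Q q) where

  open FieldLemmas F
  open FieldNotions F
  open Polynomials F
  open ψ-Calculus F seq
  open Evaluation F
  open LinearForms F seq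
  open IsLinearForm
  open IsBasic q-basic
  open ShiftInvariant Q∈Σ renaming (isLinear to Q-linear; commutes to Q-commutes)
  open RingProperties ring using (-‿distribˡ-*; -0#≈0#)
  open SetoidReasoning setoid

  -- A bound takes the place of the degree: vanishing of a coefficient need not be decidable in a
  -- Heyting field, but the length of the list always gives a bound.
  DegreeBelow : ℕ → Poly → Set ℓ₁
  DegreeBelow N v = ∀ m → N ≤ m → coeff v m ≈ 0#

  length-DegreeBelow : ∀ {N} v → length v ≤ N → DegreeBelow N v
  length-DegreeBelow v v≤N m N≤m = coeff-beyond v (ℕ.≤-trans v≤N N≤m)

  -- As `q N` has an invertible coefficient at `N` and none beyond, subtracting a multiple of it
  -- cancels that coefficient of `v` and lowers the bound by one.
  agree-on-basis : ∀ {φ χ} → IsLinearForm φ → IsLinearForm χ → ∀ N →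
    (∀ n → n < N → φ (q n) ≈ χ (q n)) → ∀ v → DegreeBelow N v → φ v ≈ χ v
  agree-on-basis {φ} {χ} φ-form χ-form zero    agree v v<N = begin
    φ v   ≈⟨ cong φ-form v 0ᴾ (λ m → v<N m z≤n) ⟩
    φ 0ᴾ  ≈⟨ 0-homo φ-form ⟩
    0#    ≈⟨ 0-homo χ-form ⟨
    χ 0ᴾ  ≈⟨ cong χ-form v 0ᴾ (λ m → v<N m z≤n) ⟨
    χ v   ∎
  agree-on-basis {φ} {χ} φ-form χ-form (suc N) agree v v<N = begin
    φ v                  ≈⟨ split φ-form ⟩
    φ w + a * φ (q N)    ≈⟨ +-cong (agree-on-basis φ-form χ-form N (λ n n<N → agree n (ℕ.m<n⇒m<1+n n<N)) w w<N)
                                   (*-congˡ (agree N ℕ.≤-refl)) ⟩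
    χ w + a * χ (q N)    ≈⟨ split χ-form ⟨
    χ v                  ∎
    where
    lead = coeff (q N) N
    a = divide (coeff v N) lead (proj₁ (degree N))
    w = v +ᴾ (- a) *ᴾ q N

    coeff-w : ∀ m → coeff w m ≈ coeff v m - a * coeff (q N) m
    coeff-w m = trans (coeff-+ᴾ v _ m)
      (+-congˡ (trans (coeff-*ᴾ (- a) (q N) m) (sym (-‿distribˡ-* a (coeff (q N) m)))))

    a*lead : a * lead ≈ coeff v N
    a*lead = trans (*-assoc _ _ _)
      (trans (*-congˡ (reciprocal-inverseˡ lead (proj₁ (degree N)))) (*-identityʳ _))

    w<N : DegreeBelow N w
    w<N m N≤m with ℕ.m≤n⇒m<n∨m≡n N≤m
    ... | inj₁ N<m    = begin
      coeff w m                          ≈⟨ coeff-w m ⟩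
      coeff v m - a * coeff (q N) m      ≈⟨ +-cong (v<N m N<m) (-‿cong (*-congˡ (proj₂ (degree N) m N<m))) ⟩
      0# - a * 0#                        ≈⟨ +-identityˡ _ ⟩
      - (a * 0#)                         ≈⟨ -‿cong (zeroʳ a) ⟩
      - 0#                               ≈⟨ -0#≈0# ⟩
      0#                                 ∎
    ... | inj₂ ≡.refl = trans (coeff-w N) (trans (+-congˡ (-‿cong a*lead)) (-‿inverseʳ _))

    v≈w+aq : v ≈ᴾ w +ᴾ a *ᴾ q N
    v≈w+aq m = begin
      coeff v m                                      ≈⟨ +-identityʳ _ ⟨
      coeff v m + 0#                                 ≈⟨ +-congˡ (-‿inverseˡ x) ⟨
      coeff v m + (- x + x)                          ≈⟨ +-assoc _ _ _ ⟨
      coeff v m - x + x                              ≈⟨ +-cong (coeff-w m) (coeff-*ᴾ a (q N) m) ⟨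
      coeff w m + coeff (a *ᴾ q N) m                 ≈⟨ coeff-+ᴾ w (a *ᴾ q N) m ⟨
      coeff (w +ᴾ a *ᴾ q N) m                        ∎
      where x = a * coeff (q N) m

    split : ∀ {ω} → IsLinearForm ω → ω v ≈ ω w + a * ω (q N)
    split ω-form = trans (cong ω-form v _ v≈w+aq)
      (trans (+-homo ω-form w (a *ᴾ q N)) (+-congˡ (*-homo ω-form a (q N))))

  zero-on-basis : ∀ {φ} → IsLinearForm φ → ∀ N →
    (∀ n → n < N → φ (q n) ≈ 0#) → ∀ v → DegreeBelow N v → φ v ≈ 0#
  zero-on-basis φ-form = agree-on-basis φ-form zero-isLinearForm

  -- The power unfolds with the extra `Q` outermost, while `lowers` needs it next to `q n`; powers
  -- of `Q` commute, so it can be moved inside.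
  Q^-lowers : ∀ {φ} → IsLinearForm φ → ∀ k n →
    φ ((Q ^ᴼ suc k) (q n)) ≈ [ n ]ψ * φ ((Q ^ᴼ k) (q (ℕ.pred n)))
  Q^-lowers {φ} φ-form k n = begin
    φ (Q ((Q ^ᴼ k) (q n)))                    ≡⟨ ≡.cong φ (^-comm Q 1 k (q n)) ⟩
    φ ((Q ^ᴼ k) (Q (q n)))                    ≈⟨ cong Q^-form _ _ (lowers n) ⟩
    φ ((Q ^ᴼ k) ([ n ]ψ *ᴾ q (ℕ.pred n)))     ≈⟨ *-homo Q^-form [ n ]ψ (q (ℕ.pred n)) ⟩
    [ n ]ψ * φ ((Q ^ᴼ k) (q (ℕ.pred n)))      ∎
    where Q^-form = ∘^-isLinearForm φ-form Q-linear k

  -- The index descends to 0, where the factor 0ψ = 0 appears.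
  Q^-annihilates-q : ∀ {φ} → IsLinearForm φ → ∀ {n k} → n < k → φ ((Q ^ᴼ k) (q n)) ≈ 0#
  Q^-annihilates-q φ-form {zero}  {suc k} _         =
    trans (Q^-lowers φ-form k 0) (trans (*-congʳ 0ψ≈0) (zeroˡ _))
  Q^-annihilates-q φ-form {suc n} {suc k} (s≤s n<k) =
    trans (Q^-lowers φ-form k (suc n)) (trans (*-congˡ (Q^-annihilates-q φ-form n<k)) (zeroʳ _))

  -- This makes the series in powers of `Q` finite.
  Q^-annihilates : ∀ {N} v → DegreeBelow N v → ∀ {k} → N ≤ k → (Q ^ᴼ k) v ≈ᴾ 0ᴾ
  Q^-annihilates {N} v v<N {k} N≤k m = zero-on-basis
    (∘^-isLinearForm (coeff-isLinearForm m) Q-linear k) N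
    (λ n n<N → Q^-annihilates-q (coeff-isLinearForm m) (ℕ.<-≤-trans n<N N≤k)) v v<N

  -- Keeps a single cut-off `N` valid for the Taylor expansions of all Qʲv. On the basis, `Q` only
  -- lowers the index.
  Q^-DegreeBelow : ∀ {N} j v → DegreeBelow N v → DegreeBelow N ((Q ^ᴼ j) v)
  Q^-DegreeBelow     zero    v v<N = v<N
  Q^-DegreeBelow {N} (suc j) v v<N m N≤m =
    zero-on-basis (∘-isLinearForm (coeff-isLinearForm m) Q-linear) N on-q _ (Q^-DegreeBelow j v v<N)
    where
    on-q : ∀ n → n < N → coeff (Q (q n)) m ≈ 0#
    on-q n n<N = trans (Q^-lowers (coeff-isLinearForm m) 0 n) (trans (*-congˡ
      (proj₂ (degree (ℕ.pred n)) m (ℕ.<-≤-trans (ℕ.≤-<-trans ℕ.pred[n]≤n n<N) N≤m))) (zeroʳ _))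

  -- Biorthogonality of the qₙ and the forms v ↦ (Qᵏv)(0). Both indices descend together; which one
  -- reaches 0 first decides whether `q₀≈1`, `vanishes` or annihilation by `Q` ends the recursion.
  constant-term-Q^q : ∀ k n → coeff ((Q ^ᴼ k) (q n)) 0 ≈ [ n ]ψ! * coeff (x^ n) k
  constant-term-Q^q zero    zero    = trans (q₀≈1 0) (trans (sym 0ψ!≈1) (sym (*-identityʳ _)))
  constant-term-Q^q zero    (suc n) =
    trans (sym (eval-0# (q (suc n)))) (trans (vanishes (suc n) (s≤s z≤n)) (sym (zeroʳ _)))
  constant-term-Q^q (suc k) zero    =
    trans (Q^-annihilates-q (coeff-isLinearForm 0) {0} {suc k} (s≤s z≤n)) (sym (zeroʳ _))
  constant-term-Q^q (suc k) (suc n) = begin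
    coeff ((Q ^ᴼ suc k) (q (suc n))) 0             ≈⟨ Q^-lowers (coeff-isLinearForm 0) k (suc n) ⟩
    [ suc n ]ψ * coeff ((Q ^ᴼ k) (q n)) 0          ≈⟨ *-congˡ (constant-term-Q^q k n) ⟩
    [ suc n ]ψ * ([ n ]ψ! * coeff (x^ n) k)        ≈⟨ *-assoc _ _ _ ⟨
    [ suc n ]ψ * [ n ]ψ! * coeff (x^ n) k          ≈⟨ *-congʳ (ψ!-suc n) ⟩
    [ suc n ]ψ! * coeff (x^ n) k                   ∎

  -- The Taylor expansion v = Σₖ (Qᵏv)(0)/kψ! qₖ, stated under a linear form.
  taylor : ∀ {φ} → IsLinearForm φ → ∀ N v → DegreeBelow N v →
    φ v ≈ ∑< N (λ k → (coeff ((Q ^ᴼ k) v) 0 /[ k ]ψ!) * φ (q k))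
  taylor {φ} φ-form N = agree-on-basis φ-form
    (∑-isLinearForm N (λ k → *-isLinearForm (*-isLinearForm
      (∘^-isLinearForm (coeff-isLinearForm 0) Q-linear k)
      (reciprocal [ k ]ψ! (ψ!#0 k))) (φ (q k)))) N on-q
    where
    on-q : ∀ n → n < N →
      φ (q n) ≈ ∑< N (λ k → (coeff ((Q ^ᴼ k) (q n)) 0 /[ k ]ψ!) * φ (q k))
    on-q n n<N = sym (begin
      ∑< N (λ k → (coeff ((Q ^ᴼ k) (q n)) 0 /[ k ]ψ!) * φ (q k))
        ≈⟨ ∑<-cong N (λ k → begin
             (coeff ((Q ^ᴼ k) (q n)) 0 /[ k ]ψ!) * φ (q k)     ≈⟨ /ψ!-*-swap (coeff ((Q ^ᴼ k) (q n)) 0) (φ (q k)) k ⟩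
             (φ (q k) /[ k ]ψ!) * coeff ((Q ^ᴼ k) (q n)) 0     ≈⟨ *-congˡ (constant-term-Q^q k n) ⟩
             (φ (q k) /[ k ]ψ!) * ([ n ]ψ! * coeff (x^ n) k)   ≈⟨ *-assoc _ _ _ ⟨
             (φ (q k) /[ k ]ψ!) * [ n ]ψ! * coeff (x^ n) k     ∎) ⟩
      ∑< N (λ k → (φ (q k) /[ k ]ψ!) * [ n ]ψ! * coeff (x^ n) k)
        ≈⟨ ∑<-δ n<N (λ k → (φ (q k) /[ k ]ψ!) * [ n ]ψ!) ⟩
      (φ (q n) /[ n ]ψ!) * [ n ]ψ!
        ≈⟨ /ψ!-*ψ! (φ (q n)) n ⟩
      φ (q n) ∎)

  constant-terms-separate : ∀ u v →
    (∀ j → coeff ((Q ^ᴼ j) u) 0 ≈ coeff ((Q ^ᴼ j) v) 0) → u ≈ᴾ v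
  constant-terms-separate u v same m = begin
    coeff u m                                                        ≈⟨ expand u (ℕ.m≤m⊔n _ _) ⟩
    ∑< N (λ k → (coeff ((Q ^ᴼ k) u) 0 /[ k ]ψ!) * coeff (q k) m)     ≈⟨ ∑<-cong N (λ k →
      *-congʳ {coeff (q k) m} (*-congʳ {reciprocal [ k ]ψ! (ψ!#0 k)} (same k))) ⟩
    ∑< N (λ k → (coeff ((Q ^ᴼ k) v) 0 /[ k ]ψ!) * coeff (q k) m)     ≈⟨ expand v (ℕ.m≤n⊔m (length u) _) ⟨
    coeff v m                                                        ∎
    where
    -- A common cut-off allows the two expansions to be compared term by term.
    N = length u ⊔ length v
    expand : ∀ w → length w ≤ N →
      coeff w m ≈ ∑< N (λ k → (coeff ((Q ^ᴼ k) w) 0 /[ k ]ψ!) * coeff (q k) m)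
    expand w w≤N = taylor (coeff-isLinearForm m) N w (length-DegreeBelow w w≤N)

  -- The Sheffer expansion of a ψ-shift.

  Q^-commutes-E : ∀ {φ} → IsLinearForm φ → ∀ y j v → φ ((Q ^ᴼ j) (E y v)) ≈ φ (E y ((Q ^ᴼ j) v))
  Q^-commutes-E φ-form y zero    v = refl
  Q^-commutes-E φ-form y (suc j) v =
    trans (Q^-commutes-E (∘-isLinearForm φ-form Q-linear) y j v)
          (cong φ-form _ _ (Q-commutes y ((Q ^ᴼ j) v)))

  -- Both sides have the same Qʲ-constant terms: on the right these are the
  -- values (Qʲv)(y), on the left the Taylor expansion of S⁻¹QʲSv = Qʲv at y.
  sheffer-expansion : ∀ S S⁻¹ → IsLinear S → IsInverse S S⁻¹ →
    (s : ℕ → Poly) → (∀ n → s n ≈ᴾ S⁻¹ (q n)) →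
    ∀ v → (∀ j → (Q ^ᴼ j) (S v) ≈ᴾ S ((Q ^ᴼ j) v)) →
    ∀ N → DegreeBelow N (S v) → ∀ y →
    (sum< N) (λ k → (eval (s k) y /[ k ]ψ!) *ᴾ (Q ^ᴼ k) (S v)) ≈ᴾ E y v
  sheffer-expansion S S⁻¹ S-linear inverse s s≈S⁻¹q v comm N Sv<N y =
    constant-terms-separate _ (E y v) λ j → begin
      coeff ((Q ^ᴼ j) ((sum< N) (λ k → (eval (s k) y /[ k ]ψ!) *ᴾ (Q ^ᴼ k) (S v)))) 0
        ≈⟨ sum-*-homo (∘^-isLinearForm (coeff-isLinearForm 0) Q-linear j) N
             (λ k → eval (s k) y /[ k ]ψ!) (λ k → (Q ^ᴼ k) (S v)) ⟩
      ∑< N (λ k → (eval (s k) y /[ k ]ψ!) * coeff ((Q ^ᴼ j) ((Q ^ᴼ k) (S v))) 0)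
        ≈⟨ ∑<-cong N (term j) ⟩
      ∑< N (λ k → (coeff ((Q ^ᴼ k) ((Q ^ᴼ j) (S v))) 0 /[ k ]ψ!) * eval (S⁻¹ (q k)) y)
        ≈⟨ taylor (∘-inverse-isLinearForm (eval-isLinearForm y)) N _
             (Q^-DegreeBelow j (S v) Sv<N) ⟨
      eval (S⁻¹ ((Q ^ᴼ j) (S v))) y
        ≈⟨ eval-cong (S⁻¹ ((Q ^ᴼ j) (S v))) ((Q ^ᴼ j) v) y
             (inverse-unique ((Q ^ᴼ j) (S v)) ((Q ^ᴼ j) v) (comm j)) ⟩
      eval ((Q ^ᴼ j) v) y
        ≈⟨ constant-term-E y ((Q ^ᴼ j) v) ⟨
      coeff (E y ((Q ^ᴼ j) v)) 0
        ≈⟨ Q^-commutes-E (coeff-isLinearForm 0) y j v ⟨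
      coeff ((Q ^ᴼ j) (E y v)) 0 ∎
    where
    open Inverses S S⁻¹ S-linear inverse

    term : ∀ j k →
      (eval (s k) y /[ k ]ψ!) * coeff ((Q ^ᴼ j) ((Q ^ᴼ k) (S v))) 0 ≈
      (coeff ((Q ^ᴼ k) ((Q ^ᴼ j) (S v))) 0 /[ k ]ψ!) * eval (S⁻¹ (q k)) y
    term j k = begin
      (eval (s k) y /[ k ]ψ!) * coeff ((Q ^ᴼ j) ((Q ^ᴼ k) (S v))) 0
        ≈⟨ *-cong (*-congʳ (eval-cong (s k) (S⁻¹ (q k)) y (s≈S⁻¹q k)))
             (reflexive (≡.cong (λ w → coeff w 0) (^-comm Q j k (S v)))) ⟩
      (eval (S⁻¹ (q k)) y /[ k ]ψ!) * coeff ((Q ^ᴼ k) ((Q ^ᴼ j) (S v))) 0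
        ≈⟨ /ψ!-*-swap _ _ k ⟩
      (coeff ((Q ^ᴼ k) ((Q ^ᴼ j) (S v))) 0 /[ k ]ψ!) * eval (S⁻¹ (q k)) y ∎

  -- Commutation of shift-invariant operators with powers of `Q`.

  combination : ℕ → (ℕ → Carrier) → Poly
  combination N a = (sum< N) (λ k → (a k /[ k ]ψ!) *ᴾ q k)

  -- By biorthogonality the scalars `a j` can be recovered from the polynomial `combination N a`, so
  -- equal polynomials have equal scalars.
  constant-term-Q^-combination : ∀ {N j} → j < N → ∀ a → coeff ((Q ^ᴼ j) (combination N a)) 0 ≈ a j
  constant-term-Q^-combination {N} {j} j<N a = begin
    coeff ((Q ^ᴼ j) (combination N a)) 0
      ≈⟨ sum-*-homo (∘^-isLinearForm (coeff-isLinearForm 0) Q-linear j) N (λ k → a k /[ k ]ψ!) q ⟩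
    ∑< N (λ k → (a k /[ k ]ψ!) * coeff ((Q ^ᴼ j) (q k)) 0)
      ≈⟨ ∑<-cong N (λ k → begin
           (a k /[ k ]ψ!) * coeff ((Q ^ᴼ j) (q k)) 0       ≈⟨ *-congˡ (constant-term-Q^q j k) ⟩
           (a k /[ k ]ψ!) * ([ k ]ψ! * coeff (x^ k) j)     ≈⟨ *-assoc _ _ _ ⟨
           -- The delta is transposed because `∑<-δ` sums over the coefficient index.
           (a k /[ k ]ψ!) * [ k ]ψ! * coeff (x^ k) j       ≈⟨ *-cong (/ψ!-*ψ! (a k) k) (reflexive (δ-sym k j)) ⟩
           a k * coeff (x^ j) k                            ∎) ⟩
    ∑< N (λ k → a k * coeff (x^ j) k)
      ≈⟨ ∑<-δ j<N a ⟩
    a j ∎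

  -- The expansion Eʸ = Σₖ qₖ(y)/kψ! Qᵏ under φ, read as a polynomial in the shift parameter `y`.
  eval-combination : ∀ {φ} → IsLinearForm φ → ∀ N v → length v ≤ N → ∀ y →
    eval (combination N (λ k → φ ((Q ^ᴼ k) v))) y ≈ φ (E y v)
  eval-combination {φ} φ-form N v v≤N y = begin
    eval (combination N (λ k → φ ((Q ^ᴼ k) v))) y
      ≈⟨ sum-*-homo (eval-isLinearForm y) N (λ k → φ ((Q ^ᴼ k) v) /[ k ]ψ!) q ⟩
    ∑< N (λ k → (φ ((Q ^ᴼ k) v) /[ k ]ψ!) * eval (q k) y)
      ≈⟨ ∑<-cong N (λ k → /ψ!-*-swap (φ ((Q ^ᴼ k) v)) (eval (q k) y) k) ⟩
    ∑< N (λ k → (eval (q k) y /[ k ]ψ!) * φ ((Q ^ᴼ k) v))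
      ≈⟨ sum-*-homo φ-form N (λ k → eval (q k) y /[ k ]ψ!) (λ k → (Q ^ᴼ k) v) ⟨
    φ ((sum< N) (λ k → (eval (q k) y /[ k ]ψ!) *ᴾ (Q ^ᴼ k) v))
      -- For the identity operator the required commutation with Qʲ is trivial, so there is no
      -- circularity in deducing the general commutation from this case.
      ≈⟨ cong φ-form _ _ (sheffer-expansion id id id-linear ((λ u≈v → u≈v) , (λ u≈v → u≈v)) q (λ _ _ → refl)
           v (λ _ _ → refl) N (length-DegreeBelow v v≤N) y) ⟩
    φ (E y v) ∎
    where
    id-linear : IsLinear id
    id-linear = record
      { +ᴹ-isGroupHomomorphism = record
        { isMonoidHomomorphism = record
          { isMagmaHomomorphism = record
            { isRelHomomorphism = record { cong = λ u≈v → u≈v }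
            ; homo = λ _ _ _ → refl
            }
          ; ε-homo = λ _ → refl
          }
        ; ⁻¹-homo = λ _ _ → refl
        }
      ; *ₗ-homo = λ _ _ _ → refl
      }

  -- Expanding S Eʸ v = Eʸ S v by the Sheffer expansion of the identity operator
  -- gives two polynomials in y with the same values, hence with the same
  -- coefficients with respect to the basis qⱼ.
  Q^-commutes : CharacteristicZero → ∀ S → ShiftInvariant S →
    ∀ v j → (Q ^ᴼ j) (S v) ≈ᴾ S ((Q ^ᴼ j) v)
  Q^-commutes char0 S S∈Σ v j m = begin
    coeff ((Q ^ᴼ j) (S v)) m          ≈⟨ constant-term-Q^-combination j<N (λ k → coeff ((Q ^ᴼ k) (S v)) m) ⟨
    coeff ((Q ^ᴼ j) g) 0              ≈⟨ cong (∘^-isLinearForm (coeff-isLinearForm 0) Q-linear j) g h g≈h ⟩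
    coeff ((Q ^ᴼ j) h) 0              ≈⟨ constant-term-Q^-combination j<N (λ k → coeff (S ((Q ^ᴼ k) v)) m) ⟩
    coeff (S ((Q ^ᴼ j) v)) m          ∎
    where
    module S = ShiftInvariant S∈Σ
    -- `suc j` places the index `j` inside the sum, so that its scalar can be recovered; the two
    -- lengths make the expansions of Eʸv and EʸSv complete.
    N = suc j ⊔ (length v ⊔ length (S v))
    j<N : j < N
    j<N = ℕ.m≤m⊔n (suc j) (length v ⊔ length (S v))
    g = combination N (λ k → coeff ((Q ^ᴼ k) (S v)) m)
    h = combination N (λ k → coeff (S ((Q ^ᴼ k) v)) m)

    g≈h : g ≈ᴾ h
    g≈h = eval-injective char0 g h λ y → begin
      eval g y            ≈⟨ eval-combination (coeff-isLinearForm m) N (S v)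
                               (ℕ.≤-trans (ℕ.m≤n⊔m (length v) _) (ℕ.m≤n⊔m (suc j) _)) y ⟩
      coeff (E y (S v)) m ≈⟨ S.commutes y v m ⟨
      coeff (S (E y v)) m ≈⟨ eval-combination (∘-isLinearForm (coeff-isLinearForm m) S.isLinear) N v
                               (ℕ.≤-trans (ℕ.m≤m⊔n (length v) _) (ℕ.m≤n⊔m (suc j) _)) y ⟨
      eval h y            ∎

mainTheorem15 : ∀ {c ℓ₁ ℓ₂} (F : HeytingField c ℓ₁ ℓ₂)
    (let open HeytingField F using (Carrier))
    (let open FieldNotions F)
    (let open Polynomials F) →
    CharacteristicZero →
    (seq : ψ-Sequence)
    (let open ψ-Calculus F seq) →
    (Q : Operator) → IsDelta Q →
    (q : ℕ → Poly) → IsBasic Q q →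
    (S S⁻¹ : Operator) → ShiftInvariant S → IsInverse S S⁻¹ →
    (s : ℕ → Poly) → (∀ n → s n ≈ᴾ S⁻¹ (q n)) →
    (T : Operator) → ShiftInvariant T →
    (p : Poly) (y : Carrier) →
    (λ k → (eval (s k) y /[ k ]ψ!) *ᴾ (Q ^ᴼ k) (S (T p))) SumsTo T (p [x+ψ y ])
mainTheorem15 F char0 seq Q Q-delta q q-basic S S⁻¹ S∈Σ inverse s s≈S⁻¹q T T∈Σ p y =
  -- From the length of STp onwards, Qᵏ annihilates STp. The sum up to there is EʸTp, which equals
  -- TEʸp by shift invariance of `T`.
  length u , vanish , λ m → trans
    (sheffer-expansion S S⁻¹ (ShiftInvariant.isLinear S∈Σ) inverse s s≈S⁻¹q (T p)
      (Q^-commutes char0 S S∈Σ (T p)) (length u) u<N y m)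
    (sym (ShiftInvariant.commutes T∈Σ y p m))
  where
  open FieldLemmas F using (_≈_; trans; sym; *-congˡ; zeroʳ)
  open Polynomials F
  open ψ-Calculus F seq
  open BasicSequences F seq (IsDelta.shiftInvariant Q-delta) q-basic

  u = S (T p)

  u<N : DegreeBelow (length u) u
  u<N = length-DegreeBelow u ℕ.≤-refl

  vanish : ∀ k → length u ≤ k → (eval (s k) y /[ k ]ψ!) *ᴾ (Q ^ᴼ k) u ≈ᴾ 0ᴾ
  vanish k N≤k m = trans (coeff-*ᴾ (eval (s k) y /[ k ]ψ!) ((Q ^ᴼ k) u) m)
    (trans (*-congˡ (Q^-annihilates u u<N N≤k m)) (zeroʳ (eval (s k) y /[ k ]ψ!)))
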